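{- Every quasi-interpretation of a program is a sup-interpretation (of that program).
   Context: **Programs.** The vocabulary consists of four disjoint sets of symbols: variables $\mathit{Var}$, constructor symbols $\mathit{Cns}$, operator symbols $\mathit{Op}$, function symbols $\mathit{Fct}$; all symbols of the last three sets have an arity. Compositional expressions are $e ::= x \mid c(e_1,\ldots,e_n)\mid op(e_1,\ldots,e_n)\mid f(e_1,\ldots,e_n)$ with $x\in\mathit{Var}$, $c\in\mathit{Cns}$, $op\in\mathit{Op}$, $f\in\mathit{Fct}$; patterns are $p::=x\mid c(p_1,\ldots,p_n)$. A program is a finite list of definitions, one $f(x_1,\ldots,x_n)=e^f$ for each of its function symbols $f$, where $e^f$ is either a compositional expression, or $\mathbf{Case}\ x_1,\ldots,x_n\ \mathbf{of}\ \overline{p_1}\to e^1\ \ldots\ \overline{p_\ell}\to e^\ell$ where each $\overline{p_j}=p_{j,1},\ldots,p_{j,n}$ is a sequence of $n$ patterns, the pattern sequences are non-overlapping, and each $e^j$ is a compositional expression (no nested Case). Every variable of $e^f$ is a parameter $x_i$ or occurs in a pattern (of the branch considered). **Semantics.** $\mathit{Values}$ is the set of ground constructor terms, $\mathit{Values}^*=\mathit{Values}\cup\{\mathbf{Err}\}$. Each operator $op$ of arity $n$ is interpreted by a function $[\![op]\!]$ from $\mathit{Values}^n$ to $\mathit{Values}^*$. Operators are basic partial functions: destructors (returning a subterm of an argument, or $\mathbf{Err}$) or characteristic functions of predicates (returning a $0$-ary truth-value constructor, or $\mathbf{Err}$). Evaluation $e\downarrow w$ of ground expressions is call-by-value: $c(e_1,\ldots,e_n)\downarrow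 c(w_1,\ldots,w_n)$ and $op(e_1,\ldots,e_n)\downarrow [\![op]\!](w_1,\ldots,w_n)$ if $e_i\downarrow w_i\neq\mathbf{Err}$ for all $i$; $f(e_1,\ldots,e_n)\downarrow w$ if $e_i\downarrow w_i\ne\mathbf{Err}$ for all $i$ and $e^f\sigma\downarrow w$ with $\sigma(x_i)=w_i$, where a Case expression is evaluated by selecting the branch $j$ whose patterns match, $p_{j,i}\sigma'=w_i$, and evaluating $e^j$ under the matching substitution. If no rule is applicable the result is $\mathbf{Err}$. Write $[\![e]\!]=w$ iff $e\downarrow w$ (undefined if evaluation does not terminate), and $[\![b]\!](v_1,\ldots,v_n)=[\![b(v_1,\ldots,v_n)]\!]$ for a symbol $b$. **Size.** $|e|=0$ if $e$ is a $0$-ary symbol or $\mathbf{Err}$, and $|b(e_1,\ldots,e_n)|=1+\sum_i|e_i|$ if $n>0$. **Activation.** A one-hole context $\mathsf C[\diamond]$ is an expression with one occurrence of a fresh variable $\diamond$. An expression $d$ is activated by $f(p_1,\ldots,p_n)$ if for some one-hole context $\mathsf C$: either $e^f$ is compositional, $e^f=\mathsf C[d]$ and $p_i=x_i$ for all $i$; or $e^f$ is a Case expression and for some branch $j$, $e^j=\mathsf C[d]$ and $p_i=p_{j,i}$ for all $i$. It is maximal if there is no context $\mathsf C[\diamond]$ other than the empty one with $\mathsf C[d]$ activated by $f(p_1,\ldots,p_n)$. **Assignments.** A partial assignment $I$ maps each symbol $b$ of arity $n$ in its domain $\mathrm{dom}(I)$ to a function $I(b):(\mathbb R^+)^n\to\mathbb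 R^+$ ($\mathbb R^+$: nonnegative reals), with $\mathit{Cns}\cup\mathit{Op}\subseteq\mathrm{dom}(I)$. Its canonical extension $I^*$ to expressions whose symbols are in $\mathrm{dom}(I)$ is $I^*(x)=X$ (a variable ranging over $\mathbb R^+$, one for each $x\in\mathit{Var}$) and $I^*(b(e_1,\ldots,e_n))=I(b)(I^*(e_1),\ldots,I^*(e_n))$. Standing assumption: all assignments are additive, i.e. every $I(b)$ is bounded by a polynomial in $\mathbb R^+[X_1,\ldots,X_n]$, and each constructor $c$ of arity $n>0$ has $I(c)(X_1,\ldots,X_n)=\sum_iX_i+\alpha_c$ with $\alpha_c\ge1$; $0$-ary constructors and $\mathbf{Err}$ are assigned $0$. **Sup-interpretation.** A partial assignment $\theta$ such that: (1) each $\theta(b)$, $b\in\mathrm{dom}(\theta)$, is weakly monotonic ($X_i\ge Y_i$ for all $i$ implies $\theta(b)(X_1,\ldots,X_n)\ge\theta(b)(Y_1,\ldots,Y_n)$); (2) $\theta^*(v)\ge|v|$ for all $v\in\mathit{Values}^*$; (3) for each $b\in\mathrm{dom}(\theta)$ of arity $n$ and $v_1,\ldots,v_n\in\mathit{Values}$, if $[\![b]\!](v_1,\ldots,v_n)$ is defined in $\mathit{Values}^*$ then $\theta^*(b(v_1,\ldots,v_n))\ge\theta^*([\![b]\!](v_1,\ldots,v_n))$. **Quasi-interpretation.** A quasi-interpretation of a program is a total additive assignment $(\!|-|\!)$ (defined on every symbol of the program), extended canonically to expressions, which is (weakly) monotonic, has the subterm property ($(\!|b|\!)(\ldots,X_i,\ldots)\ge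 X_i$ for every symbol $b$ of arity $n$ and every $i\in\{1,\ldots,n\}$), and such that for every maximal expression $e$ activated by some $f(p_1,\ldots,p_n)$, $(\!|f(p_1,\ldots,p_n)|\!)\ge(\!|e|\!)$ for all nonnegative real values of the variables. -}

module Defs where

open import Data.Empty using (⊥)
open import Data.Fin using (Fin)
open import Data.Integer using (+_)
open import Data.List using (List; []; _∷_; _++_)
open import Data.List.Membership.Propositional using (_∈_; _∉_)
open import Data.List.Relation.Unary.All using (All)
open import Data.List.Relation.Unary.AllPairs using (AllPairs)
open import Data.Maybe using (Maybe; just; nothing; maybe)
open import Data.Nat as ℕ using (ℕ; zero; suc; _⊔_)
import Data.Nat.Properties as ℕ
open import Data.Product using (Σ-syntax; ∃-syntax; _×_; _,_; proj₁; proj₂)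
open import Data.Rational as ℚ using (ℚ; 0ℚ; 1ℚ; ½; 1/_)
import Data.Rational.Properties as ℚ
open import Data.Rational.Solver using (module +-*-Solver)
open import Data.Sum using (_⊎_)
open import Data.Unit using (⊤; tt)
open import Data.Vec as Vec using (Vec; []; _∷_; lookup)
import Data.Vec.Membership.Propositional as Vec
open import Data.Vec.Relation.Unary.Any as VecAny using ()
open import Data.Vec.Relation.Unary.Unique.Propositional using (Unique)
open import Data.Vec.Relation.Binary.Pointwise.Inductive using (Pointwise)
open import Relation.Binary.PropositionalEquality
  using (_≡_; _≢_; refl; sym; trans; cong; cong₂; subst)
open import Relation.Nullary using (¬_)

-- ℝ⁺ is the Cauchy completion of the nonnegative rationals. It is a setoid:
-- two sequences represent the same real when they are related by _≈_.
-- As m and n play symmetric roles, `cauchy` says ∣ seq m - seq n ∣ ≤ ε.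
record ℝ⁺ : Set where
  field
    seq    : ℕ → ℚ
    nonneg : ∀ n → 0ℚ ℚ.≤ seq n
    cauchy : ∀ ε → 0ℚ ℚ.< ε →
             ∃[ N ] (∀ m n → N ℕ.≤ m → N ℕ.≤ n → seq m ℚ.≤ seq n ℚ.+ ε)

open ℝ⁺

infix 4 _≤_ _≈_
infixl 6 _+_
infixl 7 _*_
infixr 8 _^_

_≤_ : ℝ⁺ → ℝ⁺ → Set
x ≤ y = ∀ ε → 0ℚ ℚ.< ε → ∃[ N ] (∀ n → N ℕ.≤ n → seq x n ℚ.≤ seq y n ℚ.+ ε)

_≈_ : ℝ⁺ → ℝ⁺ → Set
x ≈ y = x ≤ y × y ≤ x

private
  half-pos : ∀ {ε} → 0ℚ ℚ.< ε → 0ℚ ℚ.< ½ ℚ.* ε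
  half-pos {ε} 0<ε = subst (ℚ._< ½ ℚ.* ε) (ℚ.*-zeroʳ ½) (ℚ.*-monoʳ-<-pos ½ 0<ε)

  add-halves : ∀ a b ε →
    (a ℚ.+ ½ ℚ.* ε) ℚ.+ (b ℚ.+ ½ ℚ.* ε) ≡ (a ℚ.+ b) ℚ.+ ε
  add-halves = solve 3 (λ a b ε →
    (a :+ con ½ :* ε) :+ (b :+ con ½ :* ε) := (a :+ b) :+ ε) refl
    where open +-*-Solver

  q≤q+p : ∀ q {p} → 0ℚ ℚ.≤ p → q ℚ.≤ q ℚ.+ p
  q≤q+p q {p} 0≤p =
    subst (ℚ._≤ q ℚ.+ p) (ℚ.+-identityʳ q) (ℚ.+-monoʳ-≤ q 0≤p)

  *-nonneg : ∀ p q → 0ℚ ℚ.≤ p → 0ℚ ℚ.≤ q → 0ℚ ℚ.≤ p ℚ.* q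
  *-nonneg p q 0≤p 0≤q = subst (ℚ._≤ p ℚ.* q) (ℚ.*-zeroʳ p)
    (ℚ.*-monoˡ-≤-nonNeg p {{ℚ.nonNegative 0≤p}} 0≤q)

constant : (q : ℚ) → 0ℚ ℚ.≤ q → ℝ⁺
constant q 0≤q = record
  { seq    = λ _ → q
  ; nonneg = λ _ → 0≤q
  ; cauchy = λ ε 0<ε → 0 , λ _ _ _ _ → q≤q+p q (ℚ.<⇒≤ 0<ε)
  }

fromℕ : ℕ → ℝ⁺
fromℕ n = constant (+ n ℚ./ 1)
  (ℚ.nonNegative⁻¹ (+ n ℚ./ 1) {{ℚ.normalize-nonNeg n 1}})

0ℝ 1ℝ : ℝ⁺
0ℝ = fromℕ 0
1ℝ = fromℕ 1

_+_ : ℝ⁺ → ℝ⁺ → ℝ⁺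
x + y = record
  { seq    = λ n → seq x n ℚ.+ seq y n
  ; nonneg = λ n → ℚ.+-mono-≤ (nonneg x n) (nonneg y n)
  ; cauchy = λ ε 0<ε →
      let (M , x-cauchy) = cauchy x (½ ℚ.* ε) (half-pos 0<ε)
          (N , y-cauchy) = cauchy y (½ ℚ.* ε) (half-pos 0<ε)
      in M ⊔ N , λ m n ≤m ≤n →
        subst (seq x m ℚ.+ seq y m ℚ.≤_) (add-halves (seq x n) (seq y n) ε)
          (ℚ.+-mono-≤
            (x-cauchy m n (ℕ.m⊔n≤o⇒m≤o M N ≤m) (ℕ.m⊔n≤o⇒m≤o M N ≤n))
            (y-cauchy m n (ℕ.m⊔n≤o⇒n≤o M N ≤m) (ℕ.m⊔n≤o⇒n≤o M N ≤n)))
  }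

private
  module Product (x y : ℝ⁺) (ε : ℚ) (0<ε : 0ℚ ℚ.< ε) where
    0<1 : 0ℚ ℚ.< 1ℚ
    0<1 = ℚ.positive⁻¹ 1ℚ

    Bˣ Bʸ K : ℚ
    Bˣ = seq x (proj₁ (cauchy x 1ℚ 0<1)) ℚ.+ 1ℚ
    Bʸ = seq y (proj₁ (cauchy y 1ℚ 0<1)) ℚ.+ 1ℚ
    K  = Bˣ ℚ.+ Bʸ

    0<B : ∀ z n → 0ℚ ℚ.< seq z n ℚ.+ 1ℚ
    0<B z n = ℚ.+-mono-≤-< (nonneg z n) 0<1

    instance
      K-pos : ℚ.Positive K
      K-pos = ℚ.positive (ℚ.+-mono-< (0<B x _) (0<B y _))
      K-nonZero : ℚ.NonZero K
      K-nonZero = ℚ.pos⇒nonZero K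

    δ : ℚ
    δ = ε ℚ.* (1/ K)

    δ-pos : 0ℚ ℚ.< δ
    δ-pos = subst (ℚ._< δ) (ℚ.*-zeroˡ (1/ K))
      (ℚ.*-monoˡ-<-pos (1/ K) {{ℚ.1/pos⇒pos K}} 0<ε)

    δK≡ε : δ ℚ.* K ≡ ε
    δK≡ε = trans (ℚ.*-assoc ε (1/ K) K)
      (trans (cong (ε ℚ.*_) (ℚ.*-inverseˡ K)) (ℚ.*-identityʳ ε))

    N¹ N² N : ℕ
    N¹ = proj₁ (cauchy x 1ℚ 0<1) ⊔ proj₁ (cauchy y 1ℚ 0<1)
    N² = proj₁ (cauchy x δ δ-pos) ⊔ proj₁ (cauchy y δ δ-pos)
    N  = N¹ ⊔ N²

    rearrange : ∀ a b c d →
      (a ℚ.* b ℚ.+ a ℚ.* d) ℚ.+ d ℚ.* c ≡ a ℚ.* b ℚ.+ d ℚ.* (a ℚ.+ c)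
    rearrange = solve 4 (λ a b c d →
      (a :* b :+ a :* d) :+ d :* c := a :* b :+ d :* (a :+ c)) refl
      where open +-*-Solver

    bound : ∀ m n → N ℕ.≤ m → N ℕ.≤ n →
      seq x m ℚ.* seq y m ℚ.≤ seq x n ℚ.* seq y n ℚ.+ ε
    bound m n N≤m N≤n = begin
      xm ℚ.* ym
        ≤⟨ ℚ.*-monoʳ-≤-nonNeg ym {{ℚ.nonNegative (nonneg y m)}} xm≤ ⟩
      (xn ℚ.+ δ) ℚ.* ym
        ≡⟨ ℚ.*-distribʳ-+ ym xn δ ⟩
      xn ℚ.* ym ℚ.+ δ ℚ.* ym
        ≤⟨ ℚ.+-monoˡ-≤ (δ ℚ.* ym)
             (ℚ.*-monoˡ-≤-nonNeg xn {{ℚ.nonNegative (nonneg x n)}} ym≤) ⟩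
      xn ℚ.* (yn ℚ.+ δ) ℚ.+ δ ℚ.* ym
        ≡⟨ cong (ℚ._+ δ ℚ.* ym) (ℚ.*-distribˡ-+ xn yn δ) ⟩
      (xn ℚ.* yn ℚ.+ xn ℚ.* δ) ℚ.+ δ ℚ.* ym
        ≡⟨ rearrange xn yn ym δ ⟩
      xn ℚ.* yn ℚ.+ δ ℚ.* (xn ℚ.+ ym)
        ≤⟨ ℚ.+-monoʳ-≤ (xn ℚ.* yn)
             (ℚ.*-monoˡ-≤-nonNeg δ {{ℚ.nonNegative (ℚ.<⇒≤ δ-pos)}}
               (ℚ.+-mono-≤ xn≤Bˣ ym≤Bʸ)) ⟩
      xn ℚ.* yn ℚ.+ δ ℚ.* K
        ≡⟨ cong (xn ℚ.* yn ℚ.+_) δK≡ε ⟩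
      xn ℚ.* yn ℚ.+ ε ∎
      where
      open ℚ.≤-Reasoning
      xm = seq x m
      ym = seq y m
      xn = seq x n
      yn = seq y n

      N¹ˣ≤ : ∀ {k} → N ℕ.≤ k → proj₁ (cauchy x 1ℚ 0<1) ℕ.≤ k
      N¹ˣ≤ p = ℕ.m⊔n≤o⇒m≤o _ _ (ℕ.m⊔n≤o⇒m≤o N¹ N² p)
      N¹ʸ≤ : ∀ {k} → N ℕ.≤ k → proj₁ (cauchy y 1ℚ 0<1) ℕ.≤ k
      N¹ʸ≤ p = ℕ.m⊔n≤o⇒n≤o (proj₁ (cauchy x 1ℚ 0<1)) _ (ℕ.m⊔n≤o⇒m≤o N¹ N² p)
      N²ˣ≤ : ∀ {k} → N ℕ.≤ k → proj₁ (cauchy x δ δ-pos) ℕ.≤ k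
      N²ˣ≤ p = ℕ.m⊔n≤o⇒m≤o _ _ (ℕ.m⊔n≤o⇒n≤o N¹ N² p)
      N²ʸ≤ : ∀ {k} → N ℕ.≤ k → proj₁ (cauchy y δ δ-pos) ℕ.≤ k
      N²ʸ≤ p = ℕ.m⊔n≤o⇒n≤o (proj₁ (cauchy x δ δ-pos)) _ (ℕ.m⊔n≤o⇒n≤o N¹ N² p)

      xm≤ = proj₂ (cauchy x δ δ-pos) m n (N²ˣ≤ N≤m) (N²ˣ≤ N≤n)
      ym≤ = proj₂ (cauchy y δ δ-pos) m n (N²ʸ≤ N≤m) (N²ʸ≤ N≤n)
      xn≤Bˣ = proj₂ (cauchy x 1ℚ 0<1) n _ (N¹ˣ≤ N≤n) ℕ.≤-refl
      ym≤Bʸ = proj₂ (cauchy y 1ℚ 0<1) m _ (N¹ʸ≤ N≤m) ℕ.≤-refl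

_*_ : ℝ⁺ → ℝ⁺ → ℝ⁺
x * y = record
  { seq    = λ n → seq x n ℚ.* seq y n
  ; nonneg = λ n → *-nonneg (seq x n) (seq y n) (nonneg x n) (nonneg y n)
  ; cauchy = λ ε 0<ε → Product.N x y ε 0<ε , Product.bound x y ε 0<ε
  }

_^_ : ℝ⁺ → ℕ → ℝ⁺
x ^ zero  = 1ℝ
x ^ suc k = x * x ^ k

sum : ∀ {n} → Vec ℝ⁺ n → ℝ⁺
sum []       = 0ℝ
sum (x ∷ xs) = x + sum xs

-- Polynomials in ℝ⁺[X₁,…,Xₙ], as lists of monomials given by a coefficient
-- and a vector of exponents.
Polynomial : ℕ → Set
Polynomial n = List (ℝ⁺ × Vec ℕ n)

monomial : ∀ {n} → Vec ℕ n → Vec ℝ⁺ n → ℝ⁺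
monomial []       []       = 1ℝ
monomial (k ∷ ks) (x ∷ xs) = x ^ k * monomial ks xs

evaluate : ∀ {n} → Polynomial n → Vec ℝ⁺ n → ℝ⁺
evaluate []             xs = 0ℝ
evaluate ((a , ks) ∷ P) xs = a * monomial ks xs + evaluate P xs

-- A program has finitely many function symbols, and they are Fin numFct.
record Vocabulary : Set₁ where
  field
    Var Cns Op  : Set
    numFct      : ℕ
    cns-arity   : Cns → ℕ
    op-arity    : Op → ℕ
    fct-arity   : Fin numFct → ℕ
    TruthValue  : Cns → Set
    truth-0-ary : ∀ {c} → TruthValue c → cns-arity c ≡ 0

  Fct : Set
  Fct = Fin numFct

module _ (𝒱 : Vocabulary) where
  open Vocabulary 𝒱

  data Symbol : Set where
    cns : Cns → Symbol
    op  : Op  → Symbol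
    fct : Fct → Symbol

  arity : Symbol → ℕ
  arity (cns c) = cns-arity c
  arity (op o)  = op-arity o
  arity (fct f) = fct-arity f

  data Expr (X : Set) : Set where
    var : X → Expr X
    app : (b : Symbol) → Vec (Expr X) (arity b) → Expr X

  data ConstructorTerm (X : Set) : Set where
    var : X → ConstructorTerm X
    con : (c : Cns) → Vec (ConstructorTerm X) (cns-arity c) → ConstructorTerm X

  Pattern : Set
  Pattern = ConstructorTerm Var

  Value : Set
  Value = ConstructorTerm ⊥

  GroundExpr : Set
  GroundExpr = Expr ⊥

  data Value* : Set where
    val : Value → Value*
    Err : Value*

  ⌜_⌝  : ∀ {X} → ConstructorTerm X → Expr X
  ⌜_⌝* : ∀ {X n} → Vec (ConstructorTerm X) n → Vec (Expr X) n
  ⌜ var x ⌝    = var x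
  ⌜ con c ts ⌝ = app (cns c) ⌜ ts ⌝*
  ⌜ [] ⌝*      = []
  ⌜ t ∷ ts ⌝*  = ⌜ t ⌝ ∷ ⌜ ts ⌝*

  _[_]  : ∀ {X Y} → Expr X → (X → Expr Y) → Expr Y
  _[_]* : ∀ {X Y n} → Vec (Expr X) n → (X → Expr Y) → Vec (Expr Y) n
  var x [ σ ]     = σ x
  app b es [ σ ]  = app b (es [ σ ]*)
  [] [ σ ]*       = []
  (e ∷ es) [ σ ]* = (e [ σ ]) ∷ (es [ σ ]*)

  vars  : ∀ {X} → Expr X → List X
  vars* : ∀ {X n} → Vec (Expr X) n → List X
  vars (var x)    = x ∷ []
  vars (app b es) = vars* es
  vars* []        = []
  vars* (e ∷ es)  = vars e ++ vars* es

  application-size : (arity : ℕ) (argument-sizes : ℕ) → ℕ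
  application-size zero    _ = 0
  application-size (suc _) s = suc s

  size  : ∀ {X} → Expr X → ℕ
  sizes : ∀ {X n} → Vec (Expr X) n → ℕ
  size (var x)    = 0
  size (app b es) = application-size (arity b) (sizes es)
  sizes []        = 0
  sizes (e ∷ es)  = size e ℕ.+ sizes es

  size-value* : Value* → ℕ
  size-value* (val v) = size ⌜ v ⌝
  size-value* Err     = 0

  -- σ matches the patterns ps against the values vs. Only the restriction of
  -- σ to the variables of ps is constrained.
  Matches : ∀ {n} → Vec Pattern n → Vec Value n → (Var → GroundExpr) → Set
  Matches ps vs σ = ⌜ ps ⌝* [ σ ]* ≡ ⌜ vs ⌝*

  record Branch (n : ℕ) : Set where
    constructor _⟶_
    field
      patterns : Vec Pattern n
      rhs      : Expr Var

  open Branch public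

  data Body (n : ℕ) : Set where
    compositional : Expr Var → Body n
    case-of       : List (Branch n) → Body n

  NonOverlapping : ∀ {n} → Branch n → Branch n → Set
  NonOverlapping {n} β γ = ¬ (∃[ vs ] ∃[ σ ] ∃[ τ ]
    (Matches (patterns β) vs σ × Matches (patterns γ) vs τ))

  WellFormed : ∀ {n} → Vec Var n → Body n → Set
  WellFormed xs (compositional e) = ∀ x → x ∈ vars e → x Vec.∈ xs
  WellFormed xs (case-of βs) =
    AllPairs NonOverlapping βs ×
    All (λ β → ∀ x → x ∈ vars (rhs β) →
                 x Vec.∈ xs ⊎ x ∈ vars* ⌜ patterns β ⌝*) βs

  record Definition (n : ℕ) : Set where
    field
      params     : Vec Var n
      distinct   : Unique params
      body       : Body n
      wellFormed : WellFormed params body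

  open Definition public

  Program : Set
  Program = (f : Fct) → Definition (fct-arity f)

  data _⊴_ (u : Value) : Value → Set where
    here  : u ⊴ u
    there : ∀ {c ts t} → t Vec.∈ ts → u ⊴ t → u ⊴ con c ts

  IsDestructor : ∀ {n} → (Vec Value n → Value*) → Set
  IsDestructor F = ∀ vs →
    F vs ≡ Err ⊎ ∃[ u ] ∃[ v ] (v Vec.∈ vs × u ⊴ v × F vs ≡ val u)

  IsPredicate : ∀ {n} → (Vec Value n → Value*) → Set
  IsPredicate F = ∀ vs →
    F vs ≡ Err ⊎ ∃[ c ] ∃[ ts ] (TruthValue c × F vs ≡ val (con c ts))

  record OperatorSemantics : Set where
    field
      ⟦_⟧ₒ  : (o : Op) → Vec Value (op-arity o) → Value*
      basic : ∀ o → IsDestructor ⟦ o ⟧ₒ ⊎ IsPredicate ⟦ o ⟧ₒ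

  -- The instance of the right-hand side that a call on the values vs evaluates.
  -- Pattern variables shadow parameters, so in a Case only the parameters that
  -- do not occur in the selected patterns are bound to the arguments.
  data Unfolds {n : ℕ} (D : Definition n) (vs : Vec Value n) : GroundExpr → Set where
    direct : ∀ {e} (σ : Var → GroundExpr) → body D ≡ compositional e →
             (∀ i → σ (lookup (params D) i) ≡ ⌜ lookup vs i ⌝) →
             Unfolds D vs (e [ σ ])
    select : ∀ {βs β} (σ : Var → GroundExpr) → body D ≡ case-of βs → β ∈ βs →
             Matches (patterns β) vs σ →
             (∀ i → lookup (params D) i ∉ vars* ⌜ patterns β ⌝* →
                    σ (lookup (params D) i) ≡ ⌜ lookup vs i ⌝) →
             Unfolds D vs (rhs β [ σ ])

  data NoBranchMatches {n : ℕ} (D : Definition n) (vs : Vec Value n) : Set where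
    no-match : ∀ {βs} → body D ≡ case-of βs →
               (∀ {β} → β ∈ βs → ∀ σ → ¬ Matches (patterns β) vs σ) →
               NoBranchMatches D vs

  module _ (𝒪 : OperatorSemantics) (P : Program) where
    open OperatorSemantics 𝒪

    infix 4 _↓_

    -- All arguments are evaluated before anything else happens, so a call with
    -- a diverging argument has no value even if another argument yields Err.
    -- Besides being returned by an operator, Err is the result of stuck
    -- evaluations: on an argument equal to Err, or on a Case without a match.

    data _↓_ : GroundExpr → Value* → Set where
      cns-↓ : ∀ {c es ws} → Pointwise (λ e w → e ↓ val w) es ws →
              app (cns c) es ↓ val (con c ws)
      op-↓  : ∀ {o es ws} → Pointwise (λ e w → e ↓ val w) es ws →
              app (op o) es ↓ ⟦ o ⟧ₒ ws
      fct-↓ : ∀ {f es ws d w} → Pointwise (λ e w → e ↓ val w) es ws →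
              Unfolds (P f) ws d → d ↓ w → app (fct f) es ↓ w
      err-argument : ∀ {b es} {ws : Vec Value* (arity b)} →
                     Pointwise _↓_ es ws → VecAny.Any (_≡ Err) ws →
                     app b es ↓ Err
      err-match    : ∀ {f es ws} → Pointwise (λ e w → e ↓ val w) es ws →
                     NoBranchMatches (P f) ws → app (fct f) es ↓ Err

  -- The fresh variable ⋄ is `nothing`.
  Context : Set
  Context = Expr (Maybe Var)

  ⋄ : Context
  ⋄ = var nothing

  holes  : Context → ℕ
  holes* : ∀ {n} → Vec Context n → ℕ
  holes (var nothing)  = 1
  holes (var (just x)) = 0
  holes (app b Cs)     = holes* Cs
  holes* []            = 0
  holes* (C ∷ Cs)      = holes C ℕ.+ holes* Cs

  OneHole : Context → Set
  OneHole C = holes C ≡ 1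

  plug : Context → Expr Var → Expr Var
  plug C d = C [ maybe var d ]

  module _ (P : Program) where

    data Activated (f : Fct) (d : Expr Var) : Vec Pattern (fct-arity f) → Set where
      in-body   : ∀ {e} C → OneHole C → body (P f) ≡ compositional e →
                  e ≡ plug C d → Activated f d (Vec.map var (params (P f)))
      in-branch : ∀ {βs β} C → OneHole C → body (P f) ≡ case-of βs → β ∈ βs →
                  rhs β ≡ plug C d → Activated f d (patterns β)

    MaximalActivated : (f : Fct) → Expr Var → Vec Pattern (fct-arity f) → Set
    MaximalActivated f d ps =
      Activated f d ps ×
      ¬ (∃[ C ] (OneHole C × C ≢ ⋄ × Activated f (plug C d) ps))

  -- `fun` takes membership in the domain irrelevantly: the function assigned to
  -- a symbol does not depend on the proof that the symbol is in the domain.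
  record Assignment : Set₁ where
    field
      dom      : Symbol → Set
      cns-dom  : ∀ c → dom (cns c)
      op-dom   : ∀ o → dom (op o)
      fun      : (b : Symbol) → .(dom b) → Vec ℝ⁺ (arity b) → ℝ⁺
      fun-cong : ∀ b .(b∈ : dom b) {xs ys} → Pointwise _≈_ xs ys →
                 fun b b∈ xs ≈ fun b b∈ ys

  module _ (I : Assignment) where
    open Assignment I

    Supported  : ∀ {X} → Expr X → Set
    Supported* : ∀ {X n} → Vec (Expr X) n → Set
    Supported (var x)    = ⊤
    Supported (app b es) = dom b × Supported* es
    Supported* []        = ⊤
    Supported* (e ∷ es)  = Supported e × Supported* es

    -- The canonical extension, at a valuation ρ of the variables.
    extend  : ∀ {X} (e : Expr X) → .(Supported e) → (X → ℝ⁺) → ℝ⁺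
    extend* : ∀ {X n} (es : Vec (Expr X) n) → .(Supported* es) → (X → ℝ⁺) →
              Vec ℝ⁺ n
    extend (var x)    _ ρ = ρ x
    extend (app b es) s ρ = fun b (proj₁ s) (extend* es (proj₂ s) ρ)
    extend* []        _ ρ = []
    extend* (e ∷ es)  s ρ = extend e (proj₁ s) ρ ∷ extend* es (proj₂ s) ρ

    supported-term  : ∀ {X} (t : ConstructorTerm X) → Supported ⌜ t ⌝
    supported-terms : ∀ {X n} (ts : Vec (ConstructorTerm X) n) → Supported* ⌜ ts ⌝*
    supported-term (var x)       = tt
    supported-term (con c ts)    = cns-dom c , supported-terms ts
    supported-terms []           = tt
    supported-terms (t ∷ ts)     = supported-term t , supported-terms ts

    extend-value* : Value* → ℝ⁺
    extend-value* (val v) = extend ⌜ v ⌝ (supported-term v) λ ()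
    extend-value* Err     = 0ℝ

    Monotonic : Set
    Monotonic = ∀ b .(b∈ : dom b) {xs ys} → Pointwise _≤_ xs ys →
                fun b b∈ xs ≤ fun b b∈ ys

    Subterm : Set
    Subterm = ∀ b .(b∈ : dom b) xs i → lookup xs i ≤ fun b b∈ xs

    record Additive : Set where
      field
        poly-bounded : ∀ b .(b∈ : dom b) →
          Σ[ Q ∈ Polynomial (arity b) ] (∀ xs → fun b b∈ xs ≤ evaluate Q xs)
        cns-additive : ∀ c → 0 ℕ.< cns-arity c →
          Σ[ α ∈ ℝ⁺ ] (1ℝ ≤ α × (∀ xs → fun (cns c) (cns-dom c) xs ≈ sum xs + α))
        cns-0-ary    : ∀ c → cns-arity c ≡ 0 →
          ∀ xs → fun (cns c) (cns-dom c) xs ≈ 0ℝ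

    record IsSupInterpretation (𝒪 : OperatorSemantics) (P : Program) : Set where
      field
        additive  : Additive
        monotonic : Monotonic
        size-≤    : ∀ v → fromℕ (size-value* v) ≤ extend-value* v
        sup       : ∀ b (b∈ : dom b) (vs : Vec Value (arity b)) w →
                    _↓_ 𝒪 P (app b ⌜ vs ⌝*) w →
                    extend-value* w ≤
                    extend (app b ⌜ vs ⌝*) (b∈ , supported-terms vs) λ ()

    record IsQuasiInterpretation (P : Program) : Set where
      field
        total     : ∀ b → dom b
        additive  : Additive
        monotonic : Monotonic
        subterm   : Subterm
        maximal-≤ : ∀ f ps e → MaximalActivated P f e ps →
                    (e-supported : Supported e) (ρ : Var → ℝ⁺) →
                    extend e e-supported ρ ≤
                    extend (app (fct f) ⌜ ps ⌝*)
                      (total (fct f) , supported-terms ps) ρ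

{-# OPTIONS --safe #-}

-- By induction on evaluation, the interpretation of a ground expression bounds
-- that of its value. The case of a call uses that the whole right-hand side of a
-- definition or branch is a maximal activated expression: a proper context around
-- it would have more symbols than the right-hand side, and no other branch with
-- the same patterns exists, because the branches do not overlap. Operators are
-- handled by the subterm property, and the size bound by additivity.
module Submission where

open import Defs
open import Data.Empty using (⊥-elim)
open import Data.Fin using (zero; suc)
open import Data.Integer as ℤ using (+_)
import Data.Integer.Properties as ℤ
open import Data.List using (List)
open import Data.List.Membership.Propositional using (_∈_)
open import Data.List.Relation.Unary.All as All using ()
open import Data.List.Relation.Unary.AllPairs as AllPairs using (AllPairs)
open import Data.List.Relation.Unary.Any using (here; there)
open import Data.Maybe using (nothing; maybe)
open import Data.Nat as ℕ using (ℕ; suc; z≤n; s≤s)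
import Data.Nat.Properties as ℕ
open import Data.Product using (∃-syntax; _×_; _,_; proj₁; proj₂)
open import Data.Rational as ℚ using (0ℚ; ½)
import Data.Rational.Properties as ℚ
open import Data.Rational.Solver using (module +-*-Solver)
open import Data.Rational.Unnormalised as ℚᵘ using (mkℚᵘ; *≡*)
import Data.Rational.Unnormalised.Properties as ℚᵘ
open import Data.Sum using (_⊎_; inj₁; inj₂; [_,_]′)
open import Data.Vec as Vec using (Vec; []; _∷_; lookup)
import Data.Vec.Membership.Propositional as VecMem
open import Data.Vec.Relation.Binary.Pointwise.Inductive using (Pointwise; []; _∷_)
open import Data.Vec.Relation.Unary.Any as VecAny using (index)
open import Relation.Binary.PropositionalEquality
  using (_≡_; _≢_; refl; sym; trans; cong; cong₂; subst; subst₂)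
open import Relation.Nullary using (¬_)

open ℝ⁺

-- Order and addition on `ℝ⁺`

0<½* : ∀ {ε} → 0ℚ ℚ.< ε → 0ℚ ℚ.< ½ ℚ.* ε
0<½* {ε} 0<ε = subst (ℚ._< ½ ℚ.* ε) (ℚ.*-zeroʳ ½) (ℚ.*-monoʳ-<-pos ½ 0<ε)

p≤p+ε : ∀ p {ε} → 0ℚ ℚ.< ε → p ℚ.≤ p ℚ.+ ε
p≤p+ε p {ε} 0<ε = subst (ℚ._≤ p ℚ.+ ε) (ℚ.+-identityʳ p) (ℚ.+-monoʳ-≤ p (ℚ.<⇒≤ 0<ε))

≤-pointwise : ∀ {x y} → (∀ n → seq x n ℚ.≤ seq y n) → x ≤ y
≤-pointwise {y = y} x≤y ε 0<ε = 0 , λ n _ → ℚ.≤-trans (x≤y n) (p≤p+ε (seq y n) 0<ε)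

≤-refl : ∀ {x} → x ≤ x
≤-refl {x} = ≤-pointwise {x} {x} λ _ → ℚ.≤-refl

≤-trans : ∀ {x y z} → x ≤ y → y ≤ z → x ≤ z
≤-trans {x} {y} {z} x≤y y≤z ε 0<ε =
  let (M , p) = x≤y (½ ℚ.* ε) (0<½* 0<ε)
      (N , q) = y≤z (½ ℚ.* ε) (0<½* 0<ε)
  in M ℕ.⊔ N , λ n ≤n → begin
    seq x n
      ≤⟨ p n (ℕ.m⊔n≤o⇒m≤o M N ≤n) ⟩
    seq y n ℚ.+ ½ ℚ.* ε
      ≤⟨ ℚ.+-monoˡ-≤ (½ ℚ.* ε) (q n (ℕ.m⊔n≤o⇒n≤o M N ≤n)) ⟩
    (seq z n ℚ.+ ½ ℚ.* ε) ℚ.+ ½ ℚ.* ε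
      ≡⟨ halves (seq z n) ε ⟩
    seq z n ℚ.+ ε ∎
  where
  open ℚ.≤-Reasoning
  open +-*-Solver
  halves : ∀ a ε → (a ℚ.+ ½ ℚ.* ε) ℚ.+ ½ ℚ.* ε ≡ a ℚ.+ ε
  halves = solve 2 (λ a ε → (a :+ con ½ :* ε) :+ con ½ :* ε := a :+ ε) refl

+-mono-≤ : ∀ {w x y z} → w ≤ x → y ≤ z → w + y ≤ x + z
+-mono-≤ {w} {x} {y} {z} w≤x y≤z ε 0<ε =
  let (M , p) = w≤x (½ ℚ.* ε) (0<½* 0<ε)
      (N , q) = y≤z (½ ℚ.* ε) (0<½* 0<ε)
  in M ℕ.⊔ N , λ n ≤n →
    subst (seq w n ℚ.+ seq y n ℚ.≤_) (halves (seq x n) (seq z n) ε)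
      (ℚ.+-mono-≤ (p n (ℕ.m⊔n≤o⇒m≤o M N ≤n)) (q n (ℕ.m⊔n≤o⇒n≤o M N ≤n)))
  where
  open +-*-Solver
  halves : ∀ a b ε → (a ℚ.+ ½ ℚ.* ε) ℚ.+ (b ℚ.+ ½ ℚ.* ε) ≡ (a ℚ.+ b) ℚ.+ ε
  halves = solve 3 (λ a b ε →
    (a :+ con ½ :* ε) :+ (b :+ con ½ :* ε) := (a :+ b) :+ ε) refl

0≤ : ∀ x → 0ℝ ≤ x
0≤ x = ≤-pointwise {0ℝ} {x} (nonneg x)

-- Checked on unnormalised fractions, where all denominators are 1 and no gcd gets in the way.
/1-homo-+ : ∀ m n → + (m ℕ.+ n) ℚ./ 1 ≡ (+ m ℚ./ 1) ℚ.+ (+ n ℚ./ 1)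
/1-homo-+ m n = ℚ.toℚᵘ-injective (begin
  ℚ.toℚᵘ (+ (m ℕ.+ n) ℚ./ 1)
    ≈⟨ ℚ.toℚᵘ-fromℚᵘ (mkℚᵘ (+ (m ℕ.+ n)) 0) ⟩
  mkℚᵘ (+ (m ℕ.+ n)) 0
    ≈⟨ *≡* (cong (ℤ._* (+ 1))
         (sym (cong₂ ℤ._+_ (ℤ.*-identityʳ (+ m)) (ℤ.*-identityʳ (+ n))))) ⟩
  mkℚᵘ (+ m) 0 ℚᵘ.+ mkℚᵘ (+ n) 0
    ≈⟨ ℚᵘ.+-cong (ℚ.toℚᵘ-fromℚᵘ (mkℚᵘ (+ m) 0)) (ℚ.toℚᵘ-fromℚᵘ (mkℚᵘ (+ n) 0)) ⟨
  ℚ.toℚᵘ (+ m ℚ./ 1) ℚᵘ.+ ℚ.toℚᵘ (+ n ℚ./ 1)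
    ≈⟨ ℚ.toℚᵘ-homo-+ (+ m ℚ./ 1) (+ n ℚ./ 1) ⟨
  ℚ.toℚᵘ ((+ m ℚ./ 1) ℚ.+ (+ n ℚ./ 1)) ∎)
  where open ℚᵘ.≃-Reasoning

fromℕ-subadditive : ∀ m n → fromℕ (m ℕ.+ n) ≤ fromℕ m + fromℕ n
fromℕ-subadditive m n =
  ≤-pointwise {fromℕ (m ℕ.+ n)} {fromℕ m + fromℕ n} λ _ → ℚ.≤-reflexive (/1-homo-+ m n)

-- Compare the two positions in the list. `R` need not be symmetric, so both orders appear.
AllPairs-∈ : ∀ {a r} {A : Set a} {R : A → A → Set r} {xs : List A} {x y} →
             AllPairs R xs → x ∈ xs → y ∈ xs → x ≡ y ⊎ R x y ⊎ R y x
AllPairs-∈ (_ AllPairs.∷ _)  (here refl) (here refl) = inj₁ refl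
AllPairs-∈ (r AllPairs.∷ _)  (here refl) (there y∈)  = inj₂ (inj₁ (All.lookup r y∈))
AllPairs-∈ (r AllPairs.∷ _)  (there x∈)  (here refl) = inj₂ (inj₂ (All.lookup r x∈))
AllPairs-∈ (_ AllPairs.∷ rs) (there x∈)  (there y∈)  = AllPairs-∈ rs x∈ y∈

module _ (𝒱 : Vocabulary) where

  -- Growth of expressions under plugging

  nodes  : ∀ {X} → Expr 𝒱 X → ℕ
  nodes* : ∀ {X n} → Vec (Expr 𝒱 X) n → ℕ
  nodes (var x)    = 0
  nodes (app b es) = suc (nodes* es)
  nodes* []        = 0
  nodes* (e ∷ es)  = nodes e ℕ.+ nodes* es

  plug* : ∀ {n} → Vec (Context 𝒱) n → Expr 𝒱 (Vocabulary.Var 𝒱) →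
          Vec (Expr 𝒱 (Vocabulary.Var 𝒱)) n
  plug* Cs d = _[_]* 𝒱 Cs (maybe var d)

  -- Asking for at least one hole, rather than exactly one, lets the induction descend into any
  -- argument that contains a hole.
  nodes-plug  : ∀ C d → 1 ℕ.≤ holes 𝒱 C → nodes d ℕ.≤ nodes (plug 𝒱 C d)
  nodes-plug* : ∀ {n} (Cs : Vec (Context 𝒱) n) d → 1 ℕ.≤ holes* 𝒱 Cs →
                nodes d ℕ.≤ nodes* (plug* Cs d)
  nodes-plug (var nothing) d _ = ℕ.≤-refl
  nodes-plug (app b Cs)    d h = ℕ.m≤n⇒m≤1+n (nodes-plug* Cs d h)
  nodes-plug* (C ∷ Cs) d h with holes 𝒱 C in eq
  ... | ℕ.zero = ℕ.≤-trans (nodes-plug* Cs d h) (ℕ.m≤n+m _ _)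
  ... | suc _  =
    ℕ.≤-trans (nodes-plug C d (subst (1 ℕ.≤_) (sym eq) (s≤s z≤n))) (ℕ.m≤m+n _ _)

  -- Such a context has an application at its root, which contributes the extra node.
  nodes-plug-< : ∀ C d → OneHole 𝒱 C → C ≢ ⋄ 𝒱 → nodes d ℕ.< nodes (plug 𝒱 C d)
  nodes-plug-< (var nothing) d _ C≢⋄ = ⊥-elim (C≢⋄ refl)
  nodes-plug-< (app b Cs)    d h _   = s≤s (nodes-plug* Cs d (ℕ.≤-reflexive (sym h)))

  plug-plug-≢ : ∀ C C′ d → OneHole 𝒱 C → C ≢ ⋄ 𝒱 → OneHole 𝒱 C′ →
                d ≢ plug 𝒱 C′ (plug 𝒱 C d)
  plug-plug-≢ C C′ d h C≢⋄ h′ eq = ℕ.<-irrefl (cong nodes eq)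
    (ℕ.<-≤-trans (nodes-plug-< C d h C≢⋄)
      (nodes-plug C′ (plug 𝒱 C d) (ℕ.≤-reflexive (sym h′))))

  -- Maximality of whole right-hand sides

  module _ (P : Program 𝒱) where
    open Vocabulary 𝒱

    -- Activated with its index turned into a parameter, as unification cannot
    -- split on the indices `Vec.map var (params (P f))` and `patterns β`.
    data ActivatedBy (f : Fct) (d : Expr 𝒱 Var)
                     (ps : Vec (Pattern 𝒱) (fct-arity f)) : Set where
      in-body   : ∀ {e} C → OneHole 𝒱 C → body (P f) ≡ compositional e →
                  e ≡ plug 𝒱 C d → ActivatedBy f d ps
      in-branch : ∀ {βs β} C → OneHole 𝒱 C → body (P f) ≡ case-of βs → β ∈ βs →
                  rhs β ≡ plug 𝒱 C d → patterns β ≡ ps → ActivatedBy f d ps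

    activatedBy : ∀ {f d ps} → Activated 𝒱 P f d ps → ActivatedBy f d ps
    activatedBy (in-body C h eq e≡)         = in-body C h eq e≡
    activatedBy (in-branch C h eq β∈ rhs≡)  = in-branch C h eq β∈ rhs≡ refl

    maximal-body : ∀ {f e} → body (P f) ≡ compositional e →
                   MaximalActivated 𝒱 P f e (Vec.map var (params (P f)))
    maximal-body {f} {e} body≡ =
      -- The empty context exhibits the whole body as activated.
      in-body (⋄ 𝒱) refl body≡ refl ,
      λ (C , h , C≢⋄ , act) → larger C h C≢⋄ (activatedBy act)
      where
      larger : ∀ C → OneHole 𝒱 C → C ≢ ⋄ 𝒱 → ∀ {ps} → ¬ ActivatedBy f (plug 𝒱 C e) ps
      larger C h C≢⋄ (in-body C′ h′ body≡′ e≡) with trans (sym body≡) body≡′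
      ... | refl = plug-plug-≢ C C′ e h C≢⋄ h′ e≡
      larger C h C≢⋄ (in-branch _ _ body≡′ _ _ _) with trans (sym body≡) body≡′
      ... | ()

    -- The values `vs` and the substitution `σ` are a common match for both branches, which
    -- contradicts `NonOverlapping` if they stand at different positions. Equal patterns alone would
    -- not give this: the overlap must be witnessed by values.
    branch-unique : ∀ {f βs β γ vs σ} → body (P f) ≡ case-of βs → β ∈ βs → γ ∈ βs →
                    patterns γ ≡ patterns β → Matches 𝒱 (patterns β) vs σ →
                    β ≡ γ
    branch-unique {f} {β = _ ⟶ _} {γ = _ ⟶ _} body≡ β∈ γ∈ refl matches
      with AllPairs-∈
             (proj₁ (subst (WellFormed 𝒱 (params (P f))) body≡ (wellFormed (P f)))) β∈ γ∈
    ... | inj₁ β≡γ      = β≡γ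
    ... | inj₂ (inj₁ d) = ⊥-elim (d (_ , _ , _ , matches , matches))
    ... | inj₂ (inj₂ d) = ⊥-elim (d (_ , _ , _ , matches , matches))

    -- Activation sees only the patterns, so a second branch with the same ones could activate
    -- something larger. The match excludes it through `branch-unique`.
    maximal-branch : ∀ {f βs β vs σ} → body (P f) ≡ case-of βs → β ∈ βs →
                     Matches 𝒱 (patterns β) vs σ →
                     MaximalActivated 𝒱 P f (rhs β) (patterns β)
    maximal-branch {f} {β = β} body≡ β∈ matches =
      in-branch (⋄ 𝒱) refl body≡ β∈ refl ,
      λ (C , h , C≢⋄ , act) → larger C h C≢⋄ (activatedBy act)
      where
      larger : ∀ C → OneHole 𝒱 C → C ≢ ⋄ 𝒱 →
               ¬ ActivatedBy f (plug 𝒱 C (rhs β)) (patterns β)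
      larger C h C≢⋄ (in-body _ _ body≡′ _) with trans (sym body≡) body≡′
      ... | ()
      larger C h C≢⋄ (in-branch C′ h′ body≡′ γ∈ rhs≡ ps≡) with trans (sym body≡) body≡′
      ... | refl with branch-unique {f} body≡ β∈ γ∈ ps≡ matches
      ... | refl = plug-plug-≢ C C′ (rhs β) h C≢⋄ h′ rhs≡

  -- Lets a compositional body be treated as a branch whose patterns are the parameters.
  matches-params : ∀ {n} (xs : Vec (Vocabulary.Var 𝒱) n) (vs : Vec (Value 𝒱) n) σ →
                   (∀ i → σ (lookup xs i) ≡ ⌜_⌝ 𝒱 (lookup vs i)) →
                   Matches 𝒱 (Vec.map var xs) vs σ
  matches-params []       []       σ eq = refl
  matches-params (x ∷ xs) (v ∷ vs) σ eq =
    cong₂ _∷_ (eq zero) (matches-params xs vs σ λ i → eq (suc i))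

  -- Isolates the 0-ary case, where the size is 0; additivity provides a constant `α` only for
  -- positive arity.
  application-size-≤ : ∀ n s x → (0 ℕ.< n → fromℕ (suc s) ≤ x) →
                       fromℕ (application-size 𝒱 n s) ≤ x
  application-size-≤ ℕ.zero  s x _ = 0≤ x
  application-size-≤ (suc n) s x h = h (s≤s z≤n)

  -- Interpretation of ground expressions and substitution

  module _ (𝒪 : OperatorSemantics 𝒱) (P : Program 𝒱) (I : Assignment 𝒱)
           (quasi : IsQuasiInterpretation 𝒱 I P) where
    open Vocabulary 𝒱
    open Assignment I
    open IsQuasiInterpretation quasi
    open Additive additive

    -- Comes from totality. Since `extend` takes this proof irrelevantly, values computed with any
    -- other proof agree definitionally.
    supported  : ∀ {X} (e : Expr 𝒱 X) → Supported 𝒱 I e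
    supported* : ∀ {X n} (es : Vec (Expr 𝒱 X) n) → Supported* 𝒱 I es
    supported (var x)    = _
    supported (app b es) = total b , supported* es
    supported* []        = _
    supported* (e ∷ es)  = supported e , supported* es

    -- The substitution lemma: it carries inequalities valid at every valuation over to instances.
    extend-[]  : ∀ {X Y} (e : Expr 𝒱 X) (σ : X → Expr 𝒱 Y) ρ →
                 extend 𝒱 I (_[_] 𝒱 e σ) (supported (_[_] 𝒱 e σ)) ρ ≡
                 extend 𝒱 I e (supported e) (λ x → extend 𝒱 I (σ x) (supported (σ x)) ρ)
    extend-[]* : ∀ {X Y n} (es : Vec (Expr 𝒱 X) n) (σ : X → Expr 𝒱 Y) ρ →
                 extend* 𝒱 I (_[_]* 𝒱 es σ) (supported* (_[_]* 𝒱 es σ)) ρ ≡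
                 extend* 𝒱 I es (supported* es) (λ x → extend 𝒱 I (σ x) (supported (σ x)) ρ)
    extend-[] (var x)    σ ρ = refl
    extend-[] (app b es) σ ρ = cong (fun b (total b)) (extend-[]* es σ ρ)
    extend-[]* []       σ ρ = refl
    extend-[]* (e ∷ es) σ ρ = cong₂ _∷_ (extend-[] e σ ρ) (extend-[]* es σ ρ)

    ⟪_⟫ : GroundExpr 𝒱 → ℝ⁺
    ⟪ e ⟫ = extend 𝒱 I e (supported e) λ ()

    ⟪_⟫* : ∀ {n} → Vec (GroundExpr 𝒱) n → Vec ℝ⁺ n
    ⟪ es ⟫* = extend* 𝒱 I es (supported* es) λ ()

    -- Values and basic operators

    ∈⇒≤-fun : ∀ {b v} {vs : Vec (Value 𝒱) (arity 𝒱 b)} → v VecMem.∈ vs →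
              ⟪ ⌜_⌝ 𝒱 v ⟫ ≤ fun b (total b) ⟪ ⌜_⌝* 𝒱 vs ⟫*
    ∈⇒≤-fun {b} {v} {vs} v∈ =
      subst (_≤ fun b (total b) ⟪ ⌜_⌝* 𝒱 vs ⟫*) (lookup-index v∈)
        (subterm b (total b) ⟪ ⌜_⌝* 𝒱 vs ⟫* (index v∈))
      where
      lookup-index : ∀ {n} {us : Vec (Value 𝒱) n} (u∈ : v VecMem.∈ us) →
                     lookup ⟪ ⌜_⌝* 𝒱 us ⟫* (index u∈) ≡ ⟪ ⌜_⌝ 𝒱 v ⟫
      lookup-index (VecAny.here refl) = refl
      lookup-index {us = _ ∷ _} (VecAny.there u∈) = lookup-index u∈

    ⊴⇒≤ : ∀ {u v} → _⊴_ 𝒱 u v → ⟪ ⌜_⌝ 𝒱 u ⟫ ≤ ⟪ ⌜_⌝ 𝒱 v ⟫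
    ⊴⇒≤ {u} here = ≤-refl {⟪ ⌜_⌝ 𝒱 u ⟫}
    ⊴⇒≤ {u} {v} (there {t = t} t∈ u⊴t) =
      ≤-trans {⟪ ⌜_⌝ 𝒱 u ⟫} {⟪ ⌜_⌝ 𝒱 t ⟫} {⟪ ⌜_⌝ 𝒱 v ⟫} (⊴⇒≤ u⊴t) (∈⇒≤-fun t∈)

    -- Each constructor of positive arity adds 1 to the size and `α`, at least 1, to the
    -- interpretation.
    value-size  : ∀ v → fromℕ (size 𝒱 (⌜_⌝ 𝒱 v)) ≤ ⟪ ⌜_⌝ 𝒱 v ⟫
    value-sizes : ∀ {n} (vs : Vec (Value 𝒱) n) →
                  fromℕ (sizes 𝒱 (⌜_⌝* 𝒱 vs)) ≤ sum ⟪ ⌜_⌝* 𝒱 vs ⟫*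
    value-size (con c vs) = application-size-≤ (cns-arity c) s v λ 0<n →
      let α , 1≤α , fun≈ = cns-additive c 0<n
      in ≤-trans {fromℕ (suc s)} {Σ + α} {v}
           (≤-trans {fromℕ (suc s)} {fromℕ s + 1ℝ} {Σ + α}
             (subst (λ m → fromℕ m ≤ fromℕ s + 1ℝ) (ℕ.+-comm s 1) (fromℕ-subadditive s 1))
             (+-mono-≤ {fromℕ s} {Σ} {1ℝ} {α} (value-sizes vs) 1≤α))
           (proj₂ (fun≈ ⟪ ⌜_⌝* 𝒱 vs ⟫*))
      where
      s = sizes 𝒱 (⌜_⌝* 𝒱 vs)
      Σ = sum ⟪ ⌜_⌝* 𝒱 vs ⟫*
      v = ⟪ ⌜_⌝ 𝒱 (con c vs) ⟫
    value-sizes []       = ≤-refl {0ℝ}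
    value-sizes (v ∷ vs) =
      let s = size 𝒱 (⌜_⌝ 𝒱 v)
          t = sizes 𝒱 (⌜_⌝* 𝒱 vs)
          Σ = sum ⟪ ⌜_⌝* 𝒱 vs ⟫*
      in ≤-trans {fromℕ (s ℕ.+ t)} {fromℕ s + fromℕ t} {⟪ ⌜_⌝ 𝒱 v ⟫ + Σ}
           (fromℕ-subadditive s t)
           (+-mono-≤ {fromℕ s} {⟪ ⌜_⌝ 𝒱 v ⟫} {fromℕ t} {Σ} (value-size v) (value-sizes vs))

    -- A destructor returns a subterm of an argument, bounded by the subterm property for
    -- constructors and then for `o`. Truth values are 0-ary, so they are interpreted as 0, like
    -- `Err`.
    operator-≤ : ∀ o (vs : Vec (Value 𝒱) (op-arity o)) →
                 extend-value* 𝒱 I (OperatorSemantics.⟦_⟧ₒ 𝒪 o vs) ≤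
                 fun (op o) (total (op o)) ⟪ ⌜_⌝* 𝒱 vs ⟫*
    operator-≤ o vs =
      [ (λ destructor → destructor-≤ (destructor vs))
      , (λ predicate  → predicate-≤ (predicate vs)) ]′ (OperatorSemantics.basic 𝒪 o)
      where
      F : Value* 𝒱
      F = OperatorSemantics.⟦_⟧ₒ 𝒪 o vs
      bound : ℝ⁺
      bound = fun (op o) (total (op o)) ⟪ ⌜_⌝* 𝒱 vs ⟫*
      destructor-≤ : F ≡ Err ⊎ ∃[ u ] ∃[ v ] (v VecMem.∈ vs × _⊴_ 𝒱 u v × F ≡ val u) →
                     extend-value* 𝒱 I F ≤ bound
      destructor-≤ (inj₁ eq) rewrite eq = 0≤ bound
      destructor-≤ (inj₂ (u , v , v∈ , u⊴v , eq)) rewrite eq =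
        ≤-trans {⟪ ⌜_⌝ 𝒱 u ⟫} {⟪ ⌜_⌝ 𝒱 v ⟫} {bound} (⊴⇒≤ u⊴v) (∈⇒≤-fun v∈)
      predicate-≤ : F ≡ Err ⊎ ∃[ c ] ∃[ ts ] (TruthValue c × F ≡ val (con c ts)) →
                    extend-value* 𝒱 I F ≤ bound
      predicate-≤ (inj₁ eq) rewrite eq = 0≤ bound
      predicate-≤ (inj₂ (c , ts , truth , eq)) rewrite eq =
        ≤-trans {⟪ ⌜_⌝ 𝒱 (con c ts) ⟫} {0ℝ} {bound}
          (proj₁ (cns-0-ary c (truth-0-ary truth) ⟪ ⌜_⌝* 𝒱 ts ⟫*)) (0≤ bound)

    -- Calls, and the induction on evaluation

    maximal-instance-≤ : ∀ {f ps vs} e σ → MaximalActivated 𝒱 P f e ps →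
                         Matches 𝒱 ps vs σ →
                         ⟪ _[_] 𝒱 e σ ⟫ ≤ fun (fct f) (total (fct f)) ⟪ ⌜_⌝* 𝒱 vs ⟫*
    maximal-instance-≤ {f} {ps} {vs} e σ maximal matches =
      subst₂ _≤_ (sym (extend-[] e σ λ ()))
        (cong (fun (fct f) (total (fct f)))
          (trans (sym (extend-[]* (⌜_⌝* 𝒱 ps) σ λ ())) (cong ⟪_⟫* matches)))
        -- At the valuation induced by `σ`, the patterns take the interpretations of the matched
        -- values.
        (maximal-≤ f ps e maximal (supported e) (λ x → ⟪ σ x ⟫))

    unfolds-≤ : ∀ {f vs d} → Unfolds 𝒱 (P f) vs d →
                ⟪ d ⟫ ≤ fun (fct f) (total (fct f)) ⟪ ⌜_⌝* 𝒱 vs ⟫*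
    unfolds-≤ {f} {vs} (direct {e} σ body≡ bound) =
      maximal-instance-≤ e σ (maximal-body P body≡)
        (matches-params (params (P f)) vs σ bound)
    unfolds-≤ {f} (select {β = β} σ body≡ β∈ matches _) =
      maximal-instance-≤ (rhs β) σ (maximal-branch P {f} body≡ β∈ matches) matches

    -- Stated for all ground expressions, not only symbols applied to values, because a call
    -- continues with an instance `d` of a right-hand side. There the chain runs from `w` to `d`, to
    -- `f` on the argument values `ws`, and by monotonicity to `f` on `es`.
    ↓⇒≤  : ∀ {e w} → _↓_ 𝒱 𝒪 P e w → extend-value* 𝒱 I w ≤ ⟪ e ⟫
    ↓⇒≤* : ∀ {n} {es : Vec (GroundExpr 𝒱) n} {ws : Vec (Value 𝒱) n} →
           Pointwise (λ e w → _↓_ 𝒱 𝒪 P e (val w)) es ws →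
           Pointwise _≤_ ⟪ ⌜_⌝* 𝒱 ws ⟫* ⟪ es ⟫*
    ↓⇒≤ (cns-↓ {c} es↓) = monotonic (cns c) (total (cns c)) (↓⇒≤* es↓)
    ↓⇒≤ (op-↓ {o} {es} {ws} es↓) =
      ≤-trans {extend-value* 𝒱 I (OperatorSemantics.⟦_⟧ₒ 𝒪 o ws)}
        {fun (op o) (total (op o)) ⟪ ⌜_⌝* 𝒱 ws ⟫*} {⟪ app (op o) es ⟫}
        (operator-≤ o ws) (monotonic (op o) (total (op o)) (↓⇒≤* es↓))
    ↓⇒≤ (fct-↓ {f} {es} {ws} {d} {w} es↓ unfolds d↓) =
      ≤-trans {extend-value* 𝒱 I w} {⟪ d ⟫} {⟪ app (fct f) es ⟫} (↓⇒≤ d↓)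
        (≤-trans {⟪ d ⟫} {fun (fct f) (total (fct f)) ⟪ ⌜_⌝* 𝒱 ws ⟫*} {⟪ app (fct f) es ⟫}
          (unfolds-≤ unfolds) (monotonic (fct f) (total (fct f)) (↓⇒≤* es↓)))
    ↓⇒≤ (err-argument {b} {es} _ _) = 0≤ ⟪ app b es ⟫
    ↓⇒≤ (err-match {f} {es} _ _)    = 0≤ ⟪ app (fct f) es ⟫
    ↓⇒≤* []         = []
    ↓⇒≤* (e↓ ∷ es↓) = ↓⇒≤ e↓ ∷ ↓⇒≤* es↓

theorem3 : (𝒱 : Vocabulary) (𝒪 : OperatorSemantics 𝒱) (P : Program 𝒱) (I : Assignment 𝒱) →
    IsQuasiInterpretation 𝒱 I P → IsSupInterpretation 𝒱 I 𝒪 P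
theorem3 𝒱 𝒪 P I quasi = record
  { additive  = additive
  ; monotonic = monotonic
  ; size-≤    = λ { (val v) → value-size 𝒱 𝒪 P I quasi v
                  ; Err     → ≤-refl {0ℝ} }
  ; sup       = λ b b∈ vs w → ↓⇒≤ 𝒱 𝒪 P I quasi
  }
  where open IsQuasiInterpretation quasi
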